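{- Let $G$ be an edge-coloured graph, let $G^*$ be its condensed graph, and let $k$ be a positive integer. If $G$ has a vertex colouring producing at most $k$ unstable edges, then $G^*$ has at most $4k$ vertices and at most $2k^2+k$ edges.
   Context: An edge-coloured graph $G$ is a finite simple undirected graph in which each edge $e$ has a unique colour $\psi(e)\in\{1,\dots,t\}$ for some positive integer $t$ (not required to be a proper edge colouring). A vertex colouring $f$ assigns to each vertex $v$ a colour $f(v)\in\{1,\dots,t\}$ (not required to be proper). Under $f$, an edge $uv$ is stable if $\psi(uv)=f(u)=f(v)$, and unstable otherwise. A vertex is colourful if its incident edges have at least two different colours, and monochromatic otherwise; a monochromatic vertex of colour $c$ is one having at least one incident edge and all of whose incident edges have colour $c$. The condensed graph $G^*$ of $G$ is the edge-coloured, edge-weighted graph constructed as follows. Step 1: for each colour $c$, contract all monochromatic vertices of colour $c$ into a single vertex $v_c$ (edges between two monochromatic vertices disappear, so the vertices $v_c$ form an independent set). Step 2: for each pair of adjacent vertices, if there is only one edge between them, set its weight to 1; otherwise replace all parallel edges between them (which necessarily all have the same colour) by a single edge of that colour whose weight is the number of replaced parallel edges.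
   Formalization: As written the vertex bound fails when G* has isolated vertices (five disjoint edges of five colours, k = 1, give five vertices in G*); what is proved is at most 4k plus the number of isolated vertices of G*, and the edge bound 2k²+k as stated. -}

module Defs where

open import Data.Empty using (⊥-elim)
open import Data.Fin.Base as Fin using (Fin)
open import Data.Fin.Properties as Fin using (any?; all?)
open import Data.List.Base
  using (List; []; _∷_; length; filter; map; head; lookup; allFin; cartesianProduct; deduplicate)
open import Data.List.Properties using (filter-≐)
open import Data.List.Membership.Propositional using (_∈_)
open import Data.List.Membership.Propositional.Properties using (∈-filter⁻)
open import Data.List.Relation.Unary.Any using (here)
open import Data.Maybe.Base using (Maybe; just; nothing; _>>=_)
import Data.Maybe.Properties as Maybe
open import Data.Nat.Base using (ℕ; _<_; z<s)
open import Data.Product.Base using (_×_; _,_; ∃-syntax; uncurry; proj₁; proj₂)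
open import Data.Sum.Base as Sum using (_⊎_; inj₁; inj₂)
open import Data.Sum.Properties as Sum using (inj₁-injective; inj₂-injective)
open import Function.Base using (_∘_)
open import Relation.Binary.Definitions using (DecidableEquality)
open import Relation.Binary.PropositionalEquality
open import Relation.Nullary using (¬_; Dec; yes; no)
open import Relation.Nullary.Decidable using (¬?; _×-dec_; _⊎-dec_; _→-dec_)
open import Relation.Unary using (Decidable)

-- A finite simple graph on the vertices Fin order with edges coloured by Fin t:
-- `ψ u v ≡ just c` says that uv is an edge of colour c, `ψ u v ≡ nothing` that
-- u and v are not adjacent.
record EdgeColouredGraph (t : ℕ) : Set where
  field
    order : ℕ
    ψ     : Fin order → Fin order → Maybe (Fin t)
    ψ-sym : ∀ u v → ψ u v ≡ ψ v u
    ψ-irr : ∀ v → ψ v v ≡ nothing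

  Vertex : Set
  Vertex = Fin order

  Adjacent : Vertex → Vertex → Set
  Adjacent u v = ∃[ c ] ψ u v ≡ just c

  _≟ᶜ_ : DecidableEquality (Maybe (Fin t))
  _≟ᶜ_ = Maybe.≡-dec Fin._≟_

  adjacent? : ∀ u v → Dec (Adjacent u v)
  adjacent? u v = any? λ c → ψ u v ≟ᶜ just c

  -- Each undirected edge is listed once, as the pair (u , v) with u < v.
  IsEdge : Vertex × Vertex → Set
  IsEdge (u , v) = u Fin.< v × Adjacent u v

  isEdge? : Decidable IsEdge
  isEdge? (u , v) = u Fin.<? v ×-dec adjacent? u v

  edges : List (Vertex × Vertex)
  edges = filter isEdge? (cartesianProduct (allFin order) (allFin order))

  size : ℕ
  size = length edges

  Isolated : Vertex → Set
  Isolated v = ∀ u → ¬ Adjacent v u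

  isolated? : Decidable Isolated
  isolated? v = all? λ u → ¬? (adjacent? v u)

  #isolated : ℕ
  #isolated = length (filter isolated? (allFin order))

  MonochromaticOf : Fin t → Vertex → Set
  MonochromaticOf c v = (∃[ u ] Adjacent v u) × (∀ u → Adjacent v u → ψ v u ≡ just c)

  monochromaticOf? : ∀ c → Decidable (MonochromaticOf c)
  monochromaticOf? c v =
    any? (adjacent? v) ×-dec all? (λ u → adjacent? v u →-dec (ψ v u ≟ᶜ just c))

  module _ (f : Vertex → Fin t) where

    Stable : Vertex × Vertex → Set
    Stable (u , v) = ψ u v ≡ just (f u) × f u ≡ f v

    stable? : Decidable Stable
    stable? (u , v) = (ψ u v ≟ᶜ just (f u)) ×-dec (f u Fin.≟ f v)

    #unstable : ℕ
    #unstable = length (filter (¬? ∘ stable?) edges)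

record WeightedEdgeColouredGraph (t : ℕ) : Set where
  field
    graph : EdgeColouredGraph t

  open EdgeColouredGraph graph public

  field
    weight     : Vertex → Vertex → ℕ
    weight-sym : ∀ u v → weight u v ≡ weight v u
    weight-pos : ∀ u v → Adjacent u v → 0 < weight u v

module Condensation {t : ℕ} (G : EdgeColouredGraph t) where

  open EdgeColouredGraph G

  -- Possible vertices of the contracted graph: `inj₂ c` is the contracted
  -- vertex v_c, and `inj₁ v` is a vertex v of G that is left alone.
  Class : Set
  Class = Vertex ⊎ Fin t

  _≟ᴷ_ : DecidableEquality Class
  _≟ᴷ_ = Sum.≡-dec Fin._≟_ Fin._≟_

  -- A vertex is monochromatic of at most one colour, so the search for c below
  -- makes no choice.  Vertices without incident edges are not contracted.
  π : Vertex → Class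
  π v with any? (λ c → monochromaticOf? c v)
  ... | yes (c , _) = inj₂ c
  ... | no  _       = inj₁ v

  classes : List Class
  classes = deduplicate _≟ᴷ_ (map π (allFin order))

  -- The edge uv of G survives the contraction as an edge between x and y.
  Joins : Class → Class → Vertex × Vertex → Set
  Joins x y (u , v) = x ≢ y × ((π u ≡ x × π v ≡ y) ⊎ (π u ≡ y × π v ≡ x))

  joins? : ∀ x y → Decidable (Joins x y)
  joins? x y (u , v) =
    ¬? (x ≟ᴷ y) ×-dec ((π u ≟ᴷ x ×-dec π v ≟ᴷ y) ⊎-dec (π u ≟ᴷ y ×-dec π v ≟ᴷ x))

  parallel : Class → Class → List (Vertex × Vertex)
  parallel x y = filter (joins? x y) edges

  parallel-sym : ∀ x y → parallel x y ≡ parallel y x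
  parallel-sym x y = filter-≐ (joins? x y) (joins? y x) (flip x y , flip y x) edges
    where
    flip : ∀ x y {e} → Joins x y e → Joins y x e
    flip x y (x≢y , p) = x≢y ∘ sym , Sum.swap p

  parallel-irr : ∀ x → parallel x x ≡ []
  parallel-irr x with parallel x x in eq
  ... | []    = refl
  ... | e ∷ _ = ⊥-elim (proj₁ (proj₂ e-joins) refl)
    where
    e-joins : e ∈ edges × Joins x x e
    e-joins = ∈-filter⁻ (joins? x x) (subst (e ∈_) (sym eq) (here refl))

  -- The colour of the first parallel edge; by `parallel-colour` below, all
  -- parallel edges have this colour.
  colour : Class → Class → Maybe (Fin t)
  colour x y = head (parallel x y) >>= uncurry ψ

  multiplicity : Class → Class → ℕ
  multiplicity x y = length (parallel x y)

  multiplicity-pos : ∀ x y {c} → colour x y ≡ just c → 0 < multiplicity x y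
  multiplicity-pos x y eq with parallel x y
  ... | _ ∷ _ = z<s
  ... | []    with () ← eq

  π-inj₁ : ∀ u {a} → π u ≡ inj₁ a → u ≡ a
  π-inj₁ u eq with any? (λ c → monochromaticOf? c u)
  ... | no _  = inj₁-injective eq
  ... | yes _ with () ← eq

  π-inj₂ : ∀ u {c} → π u ≡ inj₂ c → MonochromaticOf c u
  π-inj₂ u eq with any? (λ c → monochromaticOf? c u)
  ... | yes (_ , m) = subst (λ c → MonochromaticOf c u) (inj₂-injective eq) m
  ... | no _        with () ← eq

  private
    aligned : ∀ x y {u v u′ v′} → Adjacent u v → Adjacent u′ v′ →
              π u ≡ x → π v ≡ y → π u′ ≡ x → π v′ ≡ y → ψ u v ≡ ψ u′ v′
    aligned (inj₂ c) y {u} {v} {u′} {v′} a a′ p q p′ q′ =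
      trans (proj₂ (π-inj₂ u p) v a) (sym (proj₂ (π-inj₂ u′ p′) v′ a′))
    aligned (inj₁ _) (inj₂ c) {u} {v} {u′} {v′} (d , a) (d′ , a′) p q p′ q′ =
      trans (ψ-sym u v)
        (trans (proj₂ (π-inj₂ v q) u (d , trans (ψ-sym v u) a))
          (trans (sym (proj₂ (π-inj₂ v′ q′) u′ (d′ , trans (ψ-sym v′ u′) a′)))
            (ψ-sym v′ u′)))
    aligned (inj₁ _) (inj₁ _) {u} {v} {u′} {v′} _ _ p q p′ q′ =
      cong₂ ψ (trans (π-inj₁ u p) (sym (π-inj₁ u′ p′)))
              (trans (π-inj₁ v q) (sym (π-inj₁ v′ q′)))

    adjacent-sym : ∀ {u v} → Adjacent u v → Adjacent v u
    adjacent-sym {u} {v} (c , eq) = c , trans (ψ-sym v u) eq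

    joins-colour : ∀ x y {u v u′ v′} → Adjacent u v → Adjacent u′ v′ →
                   Joins x y (u , v) → Joins x y (u′ , v′) → ψ u v ≡ ψ u′ v′
    joins-colour x y a a′ (_ , inj₁ (p , q)) (_ , inj₁ (p′ , q′)) =
      aligned x y a a′ p q p′ q′
    joins-colour x y a a′ (_ , inj₂ (p , q)) (_ , inj₂ (p′ , q′)) =
      aligned y x a a′ p q p′ q′
    joins-colour x y a a′ (_ , inj₁ (p , q)) (_ , inj₂ (p′ , q′)) =
      trans (aligned x y a (adjacent-sym a′) p q q′ p′) (ψ-sym _ _)
    joins-colour x y a a′ (_ , inj₂ (p , q)) (_ , inj₁ (p′ , q′)) =
      trans (aligned y x a (adjacent-sym a′) p q q′ p′) (ψ-sym _ _)

  parallel-colour : ∀ x y {e e′} → e ∈ parallel x y → e′ ∈ parallel x y →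
                    uncurry ψ e ≡ uncurry ψ e′
  parallel-colour x y i i′
    with e∈ , j ← ∈-filter⁻ (joins? x y) i | e′∈ , j′ ← ∈-filter⁻ (joins? x y) i′ =
    joins-colour x y (proj₂ (edge e∈)) (proj₂ (edge e′∈)) j j′
    where
    edge : ∀ {e} → e ∈ edges → IsEdge e
    edge e∈ = proj₂ (∈-filter⁻ isEdge? {xs = cartesianProduct (allFin order) (allFin order)} e∈)

  condensed : WeightedEdgeColouredGraph t
  condensed = record
    { graph = record
      { order = length classes
      ; ψ     = λ i j → colour (lookup classes i) (lookup classes j)
      ; ψ-sym = λ i j → cong (λ es → head es >>= uncurry ψ)
                          (parallel-sym (lookup classes i) (lookup classes j))
      ; ψ-irr = λ i → cong (λ es → head es >>= uncurry ψ) (parallel-irr (lookup classes i))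
      }
    ; weight     = λ i j → multiplicity (lookup classes i) (lookup classes j)
    ; weight-sym = λ i j → cong length (parallel-sym (lookup classes i) (lookup classes j))
    ; weight-pos = λ i j (_ , eq) →
        multiplicity-pos (lookup classes i) (lookup classes j) eq
    }

open Condensation public using (condensed)

{-# OPTIONS --safe #-}

-- Every colourful vertex is an end of an unstable edge, since one of its edges
-- misses its own colour.  Hence the list H of the ends of the k unstable edges,
-- of length 2k, contains all colourful vertices.  An edge uv of G that survives
-- the contraction either has both ends in H, or is stable and joins a
-- (colourful) vertex u of H to the contracted vertex v_c with c = f(u).  The
-- non-isolated vertices of G* are therefore among the 4k classes π(u), v_{f(u)}
-- with u ∈ H, and the edges of G* are among the (2k choose 2) pairs from H
-- together with the 2k pairs {π(u), v_{f(u)}}: at most 2k² + k in total.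
module Submission where

open import Defs
open import Data.Nat using (ℕ; _+_; _*_; _^_; _≤_; NonZero)
open import Data.Fin using (Fin)
open import Data.Product using (_×_; ∃-syntax)

import Data.Fin as Fin
import Data.Fin.Properties as Fin
open import Data.Empty using (⊥-elim)
open import Data.List.Base
  using (List; []; _∷_; _++_; length; map; filter; lookup; allFin; cartesianProduct)
open import Data.List.Membership.Propositional using (_∈_)
open import Data.List.Membership.Propositional.Properties
  using (∈-map⁺; ∈-++⁺ˡ; ∈-++⁺ʳ; ∈-filter⁺; ∈-filter⁻; ∈-allFin; ∈-cartesianProduct⁺; ∈-lookup)
open import Data.List.Properties using (length-map; length-++)
import Data.List.Relation.Unary.All as All
open import Data.List.Relation.Unary.AllPairs using (_∷_)
open import Data.List.Relation.Unary.Any as Any using (Any; here; there; index)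
open import Data.List.Relation.Unary.Any.Properties using (lookup-index)
open import Data.List.Relation.Unary.Unique.Propositional using (Unique)
import Data.List.Relation.Unary.Unique.Propositional.Properties as Unique
import Data.List.Relation.Unary.Unique.DecPropositional.Properties as DecUnique
open import Data.Maybe.Base using (just)
open import Data.Maybe.Properties using (just-injective)
open import Data.Nat.Properties
  using (*-cancelˡ-≡; +-mono-≤; +-monoˡ-≤; *-monoʳ-≤; ^-monoˡ-≤; ≤-trans; module ≤-Reasoning)
open import Data.Nat.Tactic.RingSolver using (solve-∀)
open import Data.Product using (_,_; proj₁; proj₂)
open import Data.Sum using (_⊎_; inj₁; inj₂) renaming (map to map-⊎)
open import Function.Base using (_∘_)
open import Relation.Binary.Definitions using (tri<; tri≈; tri>)
open import Relation.Binary.PropositionalEquality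
open import Relation.Nullary using (¬_; yes; no)
open import Relation.Nullary.Decidable using (¬?; _×-dec_; decidable-stable)

-- Counting in lists: injections and unordered pairs.

module _ {A : Set} where

  lookup-injective : ∀ {xs : List A} → Unique xs → ∀ i j → lookup xs i ≡ lookup xs j → i ≡ j
  lookup-injective (_  ∷ _)  Fin.zero    Fin.zero    _  = refl
  lookup-injective (x∉ ∷ _)  Fin.zero    (Fin.suc j) eq = ⊥-elim (All.lookup x∉ (∈-lookup j) eq)
  lookup-injective (x∉ ∷ _)  (Fin.suc i) Fin.zero    eq = ⊥-elim (All.lookup x∉ (∈-lookup i) (sym eq))
  lookup-injective (_  ∷ xs!) (Fin.suc i) (Fin.suc j) eq = cong Fin.suc (lookup-injective xs! i j eq)

  -- Each `x` is sent to a position in `ys` holding a related element. Two entries sent to the same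
  -- position are related to the same `y`, hence equal, so the map of positions is injective. A
  -- general relation in place of equality allows edges to be matched up to orientation.
  pigeonhole : ∀ {B : Set} (R : A → B → Set) {xs : List A} {ys : List B} → Unique xs →
               (∀ {x} → x ∈ xs → Any (R x) ys) →
               (∀ {x x′ y} → x ∈ xs → x′ ∈ xs → R x y → R x′ y → x ≡ x′) →
               length xs ≤ length ys
  pigeonhole R {xs} {ys} xs! cover functional = Fin.injective⇒≤ {f = hole} hole-injective
    where
    hole : Fin (length xs) → Fin (length ys)
    hole i = index (cover (∈-lookup i))

    hole-injective : ∀ {i j} → hole i ≡ hole j → i ≡ j
    hole-injective {i} {j} eq = lookup-injective xs! i j
      (functional (∈-lookup i) (∈-lookup j) (lookup-index (cover (∈-lookup i)))
        (subst (λ h → R (lookup xs j) (lookup ys h)) (sym eq) (lookup-index (cover (∈-lookup j)))))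

  -- Pairs are taken by position, each in one orientation only, so that the count is a binomial
  -- coefficient even when the list has repetitions.
  pairs : List A → List (A × A)
  pairs []       = []
  pairs (x ∷ xs) = map (x ,_) xs ++ pairs xs

  -- The formula for `n` choose 2, arranged so that neither division nor truncated subtraction
  -- occurs.
  length-pairs : ∀ xs → 2 * length (pairs xs) + length xs ≡ length xs * length xs
  length-pairs []       = refl
  length-pairs (x ∷ xs) = begin
    2 * length (map (x ,_) xs ++ pairs xs) + (1 + n)       ≡⟨ cong (λ l → 2 * l + (1 + n)) (length-++ (map (x ,_) xs)) ⟩
    2 * (length (map (x ,_) xs) + p) + (1 + n)             ≡⟨ cong (λ l → 2 * (l + p) + (1 + n)) (length-map (x ,_) xs) ⟩
    2 * (n + p) + (1 + n)                                  ≡⟨ regroup n p ⟩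
    (2 * p + n) + (1 + 2 * n)                              ≡⟨ cong (_+ (1 + 2 * n)) (length-pairs xs) ⟩
    n * n + (1 + 2 * n)                                    ≡⟨ square n ⟩
    (1 + n) * (1 + n)                                      ∎
    where
    open ≡-Reasoning
    n = length xs
    p = length (pairs xs)
    regroup : ∀ n p → 2 * (n + p) + (1 + n) ≡ (2 * p + n) + (1 + 2 * n)
    regroup = solve-∀
    square : ∀ n → n * n + (1 + 2 * n) ≡ (1 + n) * (1 + n)
    square = solve-∀

  -- Distinct elements sit at distinct positions, and the earlier position determines the
  -- orientation.
  ∈-pairs : ∀ {xs x y} → x ∈ xs → y ∈ xs → x ≢ y → (x , y) ∈ pairs xs ⊎ (y , x) ∈ pairs xs
  ∈-pairs (here refl) (here refl) x≢y = ⊥-elim (x≢y refl)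
  ∈-pairs (here refl) (there y∈)  _   = inj₁ (∈-++⁺ˡ (∈-map⁺ _ y∈))
  ∈-pairs (there x∈)  (here refl) _   = inj₂ (∈-++⁺ˡ (∈-map⁺ _ x∈))
  ∈-pairs {_ ∷ xs} (there x∈) (there y∈) x≢y =
    map-⊎ (∈-++⁺ʳ (map _ xs)) (∈-++⁺ʳ (map _ xs)) (∈-pairs x∈ y∈ x≢y)

-- Adjacency and the edge list.

module _ {t : ℕ} (G : EdgeColouredGraph t) where

  open EdgeColouredGraph G

  Adjacent-sym : ∀ {u v} → Adjacent u v → Adjacent v u
  Adjacent-sym {u} {v} (c , eq) = c , trans (ψ-sym v u) eq

  Adjacent⇒≢ : ∀ {u v} → Adjacent u v → u ≢ v
  Adjacent⇒≢ {u} (c , eq) refl with () ← trans (sym (ψ-irr u)) eq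

  ∈-edges⁻ : ∀ {e} → e ∈ edges → IsEdge e
  ∈-edges⁻ = proj₂ ∘ ∈-filter⁻ isEdge? {xs = cartesianProduct (allFin order) (allFin order)}

  ∈-edges⁺ : ∀ {e} → IsEdge e → e ∈ edges
  ∈-edges⁺ = ∈-filter⁺ isEdge? (∈-cartesianProduct⁺ (∈-allFin _) (∈-allFin _))

  edges-unique : Unique edges
  edges-unique = Unique.filter⁺ isEdge?
    (Unique.cartesianProduct⁺ (Unique.allFin⁺ order) (Unique.allFin⁺ order))

-- Unstable edges and the edges that survive the contraction.

module _ {t : ℕ} (G : EdgeColouredGraph t) (f : EdgeColouredGraph.Vertex G → Fin t) where

  open EdgeColouredGraph G
  open Condensation G hiding (condensed)

  unstable : List (Vertex × Vertex)
  unstable = filter (¬? ∘ stable? f) edges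

  -- The list H. Vertices lying on several unstable edges are kept repeatedly, which makes its
  -- length exactly twice the number of unstable edges.
  ends : List Vertex
  ends = map proj₁ unstable ++ map proj₂ unstable

  length-ends : length ends ≡ 2 * #unstable f
  length-ends = begin
    length ends                                              ≡⟨ length-++ (map proj₁ unstable) ⟩
    length (map proj₁ unstable) + length (map proj₂ unstable) ≡⟨ cong₂ _+_ (length-map proj₁ unstable) (length-map proj₂ unstable) ⟩
    #unstable f + #unstable f                                ≡⟨ double (#unstable f) ⟩
    2 * #unstable f                                          ∎
    where
    open ≡-Reasoning
    double : ∀ n → n + n ≡ 2 * n
    double = solve-∀

  Stable-sym : ∀ {u v} → Stable f (u , v) → Stable f (v , u)
  Stable-sym {u} {v} (p , q) = trans (ψ-sym v u) (trans p (cong just q)) , sym q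

  -- An edge is listed with its smaller end first, so the order of `u` and `v` decides in which half
  -- of `ends` the vertex `u` appears.
  ∈-ends : ∀ {u v} → Adjacent u v → ¬ Stable f (u , v) → u ∈ ends
  ∈-ends {u} {v} a ¬s with Fin.<-cmp u v
  ... | tri< u<v _ _ =
    ∈-++⁺ˡ (∈-map⁺ proj₁ (∈-filter⁺ (¬? ∘ stable? f) (∈-edges⁺ G (u<v , a)) ¬s))
  ... | tri≈ _ u≡v _ = ⊥-elim (Adjacent⇒≢ G a u≡v)
  ... | tri> _ _ v<u =
    ∈-++⁺ʳ (map proj₁ unstable) (∈-map⁺ proj₂
      (∈-filter⁺ (¬? ∘ stable? f) (∈-edges⁺ G (v<u , Adjacent-sym G a)) (¬s ∘ Stable-sym)))

  inj₁⇒¬monochromatic : ∀ {v a c} → π v ≡ inj₁ a → ¬ MonochromaticOf c v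
  inj₁⇒¬monochromatic {v} {c = c} eq m with Fin.any? (λ c → monochromaticOf? c v)
  ... | no ¬m = ¬m (c , m)
  ... | yes _ with () ← eq

  -- If every edge at `u` had colour `f u`, then `u`, which has the neighbour `v`, would be
  -- monochromatic and contracted. So some edge at `u` has another colour, and that edge is
  -- unstable.
  colourful∈ends : ∀ {u v a} → Adjacent u v → π u ≡ inj₁ a → u ∈ ends
  colourful∈ends {u} {v} uv eq
    with Fin.any? (λ w → adjacent? u w ×-dec ¬? (ψ u w ≟ᶜ just (f u)))
  ... | yes (w , uw , ≢fu) = ∈-ends uw (≢fu ∘ proj₁)
  ... | no none = ⊥-elim (inj₁⇒¬monochromatic eq
    ((v , uv) , λ w uw → decidable-stable (ψ u w ≟ᶜ just (f u)) (λ ≢fu → none (w , uw , ≢fu))))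

  stable-monochromatic : ∀ {u v c} → Adjacent u v → Stable f (u , v) → π u ≡ inj₂ c → c ≡ f u
  stable-monochromatic {u} {v} uv (p , _) eq =
    just-injective (trans (sym (proj₂ (π-inj₂ u eq) v uv)) p)

  data Surviving (u v : Vertex) : Set where
    both  : u ∈ ends → v ∈ ends → Surviving u v
    left  : u ∈ ends → π v ≡ inj₂ (f u) → Surviving u v
    right : v ∈ ends → π u ≡ inj₂ (f v) → Surviving u v

  surviving : ∀ {u v} → Adjacent u v → π u ≢ π v → Surviving u v
  surviving {u} {v} uv π≢ with stable? f (u , v)
  ... | no ¬s = both (∈-ends uv ¬s) (∈-ends (Adjacent-sym G uv) (¬s ∘ Stable-sym))
  ... | yes s with π u in πu | π v in πv
  ...   | inj₁ _ | inj₁ _ = both (colourful∈ends uv πu) (colourful∈ends (Adjacent-sym G uv) πv)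
  ...   | inj₁ _ | inj₂ d = left (colourful∈ends uv πu)
    (trans πv (cong inj₂ (trans (stable-monochromatic (Adjacent-sym G uv) (Stable-sym s) πv) (sym (proj₂ s)))))
  ...   | inj₂ c | inj₁ _ = right (colourful∈ends (Adjacent-sym G uv) πv)
    (trans πu (cong inj₂ (trans (stable-monochromatic uv s πu) (proj₂ s))))
  -- Both ends are contracted, and stability forces both into the class of the common colour
  -- `f u = f v`, so the edge would disappear.
  ...   | inj₂ c | inj₂ d = ⊥-elim (π≢ (cong inj₂ (begin
    c    ≡⟨ stable-monochromatic uv s πu ⟩
    f u  ≡⟨ proj₂ s ⟩
    f v  ≡⟨ stable-monochromatic (Adjacent-sym G uv) (Stable-sym s) πv ⟨
    d    ∎)))
    where open ≡-Reasoning

  colour⇒Joins : ∀ {x y c} → colour x y ≡ just c → ∃[ e ] IsEdge e × Joins x y e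
  colour⇒Joins {x} {y} eq with parallel x y in par
  ... | [] with () ← eq
  ... | e ∷ _ with e∈ , joins ← ∈-filter⁻ (joins? x y) {xs = edges} (subst (e ∈_) (sym par) (here refl)) =
    e , ∈-edges⁻ G e∈ , joins

  -- A colour is read off an actual parallel edge of `G`; symmetry of adjacency orients that edge
  -- from `x` to `y`.
  coloured⇒adjacent : ∀ {x y c} → colour x y ≡ just c →
                      ∃[ u ] ∃[ v ] Adjacent u v × π u ≡ x × π v ≡ y × x ≢ y
  coloured⇒adjacent eq with colour⇒Joins eq
  ... | (u , v) , (_ , uv) , x≢y , inj₁ (p , q) = u , v , uv , p , q , x≢y
  ... | (u , v) , (_ , uv) , x≢y , inj₂ (p , q) = v , u , Adjacent-sym G uv , q , p , x≢y

  -- The number of vertices of the condensed graph.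

  module G* = WeightedEdgeColouredGraph (condensed G)

  touched : List Class
  touched = map π ends ++ map (inj₂ ∘ f) ends

  coloured⇒touched : ∀ {x y c} → colour x y ≡ just c → x ∈ touched
  coloured⇒touched eq with coloured⇒adjacent eq
  ... | u , v , uv , refl , refl , x≢y with surviving uv x≢y
  ...   | both u∈ _   = ∈-++⁺ˡ (∈-map⁺ π u∈)
  ...   | left u∈ _   = ∈-++⁺ˡ (∈-map⁺ π u∈)
  ...   | right v∈ πu = ∈-++⁺ʳ (map π ends) (subst (_∈ map (inj₂ ∘ f) ends) (sym πu) (∈-map⁺ (inj₂ ∘ f) v∈))

  -- Classes without an edge in G* cannot be reached through a surviving edge, so they are counted
  -- separately from `touched`.
  isolatedClasses : List Class
  isolatedClasses = map (lookup classes) (filter G*.isolated? (allFin G*.order))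

  classes-unique : Unique classes
  classes-unique = DecUnique.deduplicate-! _≟ᴷ_ (map π (allFin order))

  class-cover : ∀ i → lookup classes i ∈ touched ++ isolatedClasses
  class-cover i with Fin.any? (G*.adjacent? i)
  ... | yes (j , c , eq) = ∈-++⁺ˡ (coloured⇒touched {y = lookup classes j} eq)
  ... | no ¬adj = ∈-++⁺ʳ touched (∈-map⁺ (lookup classes)
    (∈-filter⁺ G*.isolated? (∈-allFin i) (λ j a → ¬adj (j , a))))

  order-bound : G*.order ≤ 4 * #unstable f + G*.#isolated
  order-bound = begin
    length classes                       ≤⟨ pigeonhole _≡_ classes-unique cover (λ { _ _ refl refl → refl }) ⟩
    length (touched ++ isolatedClasses)  ≡⟨ length-++ touched ⟩
    length touched + length isolatedClasses
      ≡⟨ cong₂ _+_ (length-++ (map π ends)) (length-map (lookup classes) (filter G*.isolated? (allFin G*.order))) ⟩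
    length (map π ends) + length (map (inj₂ ∘ f) ends) + G*.#isolated
      ≡⟨ cong (_+ G*.#isolated) (cong₂ _+_ (trans (length-map π ends) length-ends)
                                           (trans (length-map (inj₂ ∘ f) ends) length-ends)) ⟩
    2 * #unstable f + 2 * #unstable f + G*.#isolated
      ≡⟨ cong (_+ G*.#isolated) (fourfold (#unstable f)) ⟩
    4 * #unstable f + G*.#isolated       ∎
    where
    open ≤-Reasoning
    fourfold : ∀ n → 2 * n + 2 * n ≡ 4 * n
    fourfold = solve-∀
    cover : ∀ {x} → x ∈ classes → x ∈ touched ++ isolatedClasses
    cover x∈ = subst (_∈ touched ++ isolatedClasses) (sym (lookup-index x∈)) (class-cover (index x∈))

  -- The number of edges of the condensed graph.

  candidates : List (Class × Class)
  candidates = map (λ (u , v) → π u , π v) (pairs ends) ++ map (λ u → π u , inj₂ (f u)) ends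

  -- Equality of unordered pairs: edges of G* are oriented by the order of `classes`, candidates by
  -- the order of `ends`, and the two need not agree.
  SamePair : Class × Class → Class × Class → Set
  SamePair (x , y) e = (x , y) ≡ e ⊎ (y , x) ≡ e

  coloured⇒candidate : ∀ {x y c} → colour x y ≡ just c → Any (SamePair (x , y)) candidates
  coloured⇒candidate eq with coloured⇒adjacent eq
  ... | u , v , uv , refl , refl , x≢y with surviving uv x≢y
  ...   | both u∈ v∈ with ∈-pairs u∈ v∈ (Adjacent⇒≢ G uv)
  ...     | inj₁ uv∈ = Any.map inj₁ (∈-++⁺ˡ (∈-map⁺ _ uv∈))
  ...     | inj₂ vu∈ = Any.map inj₂ (∈-++⁺ˡ (∈-map⁺ _ vu∈))
  coloured⇒candidate eq | u , v , uv , refl , refl , x≢y | left u∈ πv rewrite πv =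
    Any.map inj₁ (∈-++⁺ʳ (map _ (pairs ends)) (∈-map⁺ _ u∈))
  -- The end in H is now `v`, so the listed candidate is `(π v , π u)`, the reverse of the given
  -- pair.
  coloured⇒candidate eq | u , v , uv , refl , refl , x≢y | right v∈ πu rewrite πu =
    Any.map inj₂ (∈-++⁺ʳ (map _ (pairs ends)) (∈-map⁺ _ v∈))

  length-candidates : length candidates ≡ 2 * #unstable f ^ 2 + #unstable f
  -- After doubling, `length-pairs` applies: with `n = 2m` ends, twice the count is n² + n = 2(2m² +
  -- m).
  length-candidates = *-cancelˡ-≡ _ _ 2 (begin
    2 * length candidates           ≡⟨ cong (2 *_) (length-++ (map _ (pairs ends))) ⟩
    2 * (length (map _ (pairs ends)) + length (map _ ends))
      ≡⟨ cong (2 *_) (cong₂ _+_ (length-map _ (pairs ends)) (length-map _ ends)) ⟩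
    2 * (length (pairs ends) + length ends)                 ≡⟨ regroup (length (pairs ends)) (length ends) ⟩
    2 * length (pairs ends) + length ends + length ends     ≡⟨ cong (_+ length ends) (length-pairs ends) ⟩
    length ends * length ends + length ends                 ≡⟨ cong (λ l → l * l + l) length-ends ⟩
    2 * #unstable f * (2 * #unstable f) + 2 * #unstable f   ≡⟨ halve (#unstable f) ⟩
    2 * (2 * #unstable f ^ 2 + #unstable f)                 ∎)
    where
    open ≡-Reasoning
    regroup : ∀ p n → 2 * (p + n) ≡ 2 * p + n + n
    regroup = solve-∀
    -- n * (n * 1) is n ^ 2 unfolded: the solver does not accept _^_ here.
    halve : ∀ n → 2 * n * (2 * n) + 2 * n ≡ 2 * (2 * (n * (n * 1)) + n)
    halve = solve-∀

  size-bound : G*.size ≤ 2 * #unstable f ^ 2 + #unstable f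
  size-bound = subst (G*.size ≤_) length-candidates
    (pigeonhole (λ e → SamePair (ends-of e)) (edges-unique G*.graph) cover functional)
    where
    ends-of : G*.Vertex × G*.Vertex → Class × Class
    ends-of (i , j) = lookup classes i , lookup classes j

    cover : ∀ {e} → e ∈ G*.edges → Any (SamePair (ends-of e)) candidates
    cover {i , j} e∈ with _ , _ , eq ← ∈-edges⁻ G*.graph e∈ =
      coloured⇒candidate {lookup classes i} {lookup classes j} eq

    lookup-≡ : ∀ {i j} → lookup classes i ≡ lookup classes j → i ≡ j
    lookup-≡ = lookup-injective classes-unique _ _

    same : ∀ {i j i′ j′} → ends-of (i , j) ≡ ends-of (i′ , j′) → (i , j) ≡ (i′ , j′)
    same eq = cong₂ _,_ (lookup-≡ (cong proj₁ eq)) (lookup-≡ (cong proj₂ eq))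

    -- Since `classes` has no repetitions, such a match would give `i = j′` and `j = i′`, against
    -- the increasing order of both pairs.
    crossed : ∀ {i j i′ j′} → i Fin.< j → i′ Fin.< j′ → ends-of (i , j) ≢ ends-of (j′ , i′)
    crossed i<j i′<j′ eq with refl ← same eq = Fin.<-asym i<j i′<j′

    functional : ∀ {e e′ p} → e ∈ G*.edges → e′ ∈ G*.edges →
                 SamePair (ends-of e) p → SamePair (ends-of e′) p → e ≡ e′
    functional e∈ e′∈ r r′
      with i<j , _ ← ∈-edges⁻ G*.graph e∈ | i′<j′ , _ ← ∈-edges⁻ G*.graph e′∈ | r | r′
    ... | inj₁ p | inj₁ q = same (trans p (sym q))
    ... | inj₁ p | inj₂ q = ⊥-elim (crossed i<j i′<j′ (trans p (sym q)))
    ... | inj₂ p | inj₁ q = ⊥-elim (crossed i′<j′ i<j (trans q (sym p)))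
    ... | inj₂ p | inj₂ q = cong (λ (j , i) → i , j) (same (trans p (sym q)))

lemma6p4 : ∀ (t : ℕ) .{{_ : NonZero t}} (G : EdgeColouredGraph t) (k : ℕ) .{{_ : NonZero k}} →
    (∃[ f ] EdgeColouredGraph.#unstable G f ≤ k) →
    let open WeightedEdgeColouredGraph (condensed G) in
    (order ≤ 4 * k + #isolated) × (size ≤ 2 * k ^ 2 + k)
lemma6p4 t G k (f , #≤k) =
    -- Both bounds hold for the exact number of unstable edges and are monotone in it.
    ≤-trans (order-bound G f) (+-monoˡ-≤ _ (*-monoʳ-≤ 4 #≤k))
  , ≤-trans (size-bound G f) (+-mono-≤ (*-monoʳ-≤ 2 (^-monoˡ-≤ 2 #≤k)) #≤k)
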